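{- Assume Martin's Axiom $\mathsf{MA}$ and the negation of the Continuum Hypothesis. Then $2^\omega$ has the Grinzing property.
   Context: A subset $W$ of $2^\omega$ has the Grinzing property if $W$ is uncountable and for every uncountable $Y\subseteq W$ there exist uncountable subsets $Y_\alpha$ of $Y$, for $\alpha\in\omega_1$, such that $\mathrm{cl}(Y_\alpha)\cap\mathrm{cl}(Y_\beta)=\varnothing$ whenever $\alpha\neq\beta$, where the closure is taken in $2^\omega$. $\mathsf{MA}$ is the statement that for every non-empty ccc partial order $\mathbb{P}$ and every collection $\mathcal{D}$ of fewer than $\mathfrak{c}=2^{\omega}$ dense subsets of $\mathbb{P}$ there is a filter on $\mathbb{P}$ meeting every element of $\mathcal{D}$. -}

module Defs where

open import Axiom.ExcludedMiddle using (ExcludedMiddle)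
open import Axiom.Extensionality.Propositional using (Extensionality)
open import Data.Bool.Base using (Bool; T)
open import Data.Nat.Base using (ℕ; _<_)
open import Data.Product.Base using (Σ; ∃-syntax; _×_; _,_; proj₁)
open import Function.Base using (_∘_)
open import Function.Bundles using (Func; Injection; Inverse)
import Function.Construct.Composition as Composition
import Function.Construct.Identity as Identity
import Function.Construct.Symmetry as Symmetry
open import Induction.WellFounded using (WellFounded)
open import Level using (Level; 0ℓ; _⊔_) renaming (suc to lsuc)
open import Relation.Binary.Bundles using (Poset; Setoid)
open import Relation.Binary.Core using (Rel)
import Relation.Binary.Construct.On as On
open import Relation.Binary.PropositionalEquality using (_≡_; _→-setoid_)
import Relation.Binary.PropositionalEquality.Properties as ≡
open import Relation.Binary.Structures using (IsStrictTotalOrder)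
open import Relation.Nullary.Negation using (¬_)
open import Relation.Unary using (Pred; _∈_; _⊆_; _≬_; _⊥_)
open import Relation.Unary.Relation.Binary.Equality using (≐-setoid)

private
  variable
    a b p ℓ₁ ℓ₂ : Level

------------------------------------------------------------------------
-- Classical foundations

-- Since ExcludedMiddle decides every type (not only propositions), with
-- a witness in the positive case, it provides choice functions for
-- families of types; together with function extensionality it selects
-- representatives of equivalence classes.  The pair thus plays the role
-- of classical logic with the axiom of choice.

Classical : Set (lsuc (lsuc 0ℓ))
Classical = ExcludedMiddle (lsuc 0ℓ) × Extensionality (lsuc 0ℓ) (lsuc 0ℓ)

------------------------------------------------------------------------
-- Cardinality

⟪_⟫ : {S : Setoid a ℓ₁} → Pred (Setoid.Carrier S) p → Setoid (a ⊔ p) ℓ₁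
⟪_⟫ {S = S} A = On.setoid S (proj₁ {B = A})

Countable : Setoid a ℓ₁ → Set (a ⊔ ℓ₁)
Countable S = Injection S (≡.setoid ℕ)

infix 4 _≺ᶜ_

_≺ᶜ_ : Setoid a ℓ₁ → Setoid b ℓ₂ → Set (a ⊔ b ⊔ ℓ₁ ⊔ ℓ₂)
S ≺ᶜ R = Injection S R × ¬ Inverse S R

------------------------------------------------------------------------
-- The Cantor space

2^ω : Set
2^ω = ℕ → Bool

2^ω-setoid : Setoid 0ℓ 0ℓ
2^ω-setoid = ℕ →-setoid Bool

-- The sets cylinder n x, for n : ℕ, form a neighbourhood base at x in
-- the product topology.
cylinder : ℕ → 2^ω → Pred 2^ω 0ℓ
cylinder n x y = ∀ k → k < n → y k ≡ x k

cl : Pred 2^ω 0ℓ → Pred 2^ω 0ℓ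
cl A x = ∀ n → cylinder n x ≬ A

Uncountable : Pred 2^ω 0ℓ → Set
Uncountable A = ¬ Countable (⟪_⟫ {S = 2^ω-setoid} A)

------------------------------------------------------------------------
-- ω₁, as the set of order types of well-orders of subsets of ℕ

-- The values of lt outside dom are irrelevant.
record CountableOrdinal : Set where
  field
    dom : ℕ → Bool
    lt  : ℕ → ℕ → Bool

  elements : Setoid 0ℓ 0ℓ
  elements = ⟪_⟫ {S = ≡.setoid ℕ} (T ∘ dom)

  open Setoid elements public using () renaming (Carrier to Element; _≈_ to _≈ₑ_)

  infix 4 _<ₑ_

  _<ₑ_ : Rel Element 0ℓ
  (m , _) <ₑ (n , _) = T (lt m n)

  field
    isStrictTotalOrder : IsStrictTotalOrder _≈ₑ_ _<ₑ_
    wellFounded        : WellFounded _<ₑ_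

infix 4 _≅_

record _≅_ (α β : CountableOrdinal) : Set where
  private
    module α = CountableOrdinal α
    module β = CountableOrdinal β

  field
    bijection : Inverse α.elements β.elements

  open Inverse bijection public using (to; from)

  field
    to-mono   : ∀ {x y} → x α.<ₑ y → to x β.<ₑ to y
    from-mono : ∀ {x y} → x β.<ₑ y → from x α.<ₑ from y

≅-refl : ∀ {α} → α ≅ α
≅-refl = record
  { bijection = Identity.inverse _
  ; to-mono   = λ x<y → x<y
  ; from-mono = λ x<y → x<y
  }

≅-sym : ∀ {α β} → α ≅ β → β ≅ α
≅-sym f = record
  { bijection = Symmetry.inverse (_≅_.bijection f)
  ; to-mono   = _≅_.from-mono f
  ; from-mono = _≅_.to-mono f
  }

≅-trans : ∀ {α β γ} → α ≅ β → β ≅ γ → α ≅ γ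
≅-trans f g = record
  { bijection = Composition.inverse (_≅_.bijection f) (_≅_.bijection g)
  ; to-mono   = λ x<y → _≅_.to-mono g (_≅_.to-mono f x<y)
  ; from-mono = λ x<y → _≅_.from-mono f (_≅_.from-mono g x<y)
  }

ω₁ : Setoid 0ℓ 0ℓ
ω₁ = record
  { Carrier       = CountableOrdinal
  ; _≈_           = _≅_
  ; isEquivalence = record
    { refl  = ≅-refl
    ; sym   = ≅-sym
    ; trans = ≅-trans
    }
  }

CH : Set
CH = Inverse ω₁ 2^ω-setoid

------------------------------------------------------------------------
-- Martin's Axiom

module Forcing (ℙ : Poset 0ℓ 0ℓ 0ℓ) where
  open Poset ℙ

  Compatible : Rel Carrier 0ℓ
  Compatible p q = ∃[ r ] r ≤ p × r ≤ q

  Antichain : Pred Carrier 0ℓ → Set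
  Antichain A = ∀ {p q} → p ∈ A → q ∈ A → ¬ (p ≈ q) → ¬ Compatible p q

  CCC : Set₁
  CCC = ∀ (A : Pred Carrier 0ℓ) → Antichain A → Countable (⟪_⟫ {S = Eq.setoid} A)

  Dense : Pred Carrier 0ℓ → Set
  Dense D = ∀ p → ∃[ q ] q ≤ p × q ∈ D

  record IsFilter (F : Pred Carrier 0ℓ) : Set where
    field
      nonEmpty     : ∃[ p ] p ∈ F
      upwardClosed : ∀ {p q} → p ∈ F → p ≤ q → q ∈ F
      directed     : ∀ {p q} → p ∈ F → q ∈ F → ∃[ r ] r ∈ F × r ≤ p × r ≤ q

MA : Set₁
MA = ∀ (ℙ : Poset 0ℓ 0ℓ 0ℓ) →
  let open Poset ℙ using (Carrier)
      open Forcing ℙ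
  in
  Carrier → CCC →
  ∀ (𝒟 : Pred (Pred Carrier 0ℓ) 0ℓ) →
  ⟪_⟫ {S = ≐-setoid Carrier 0ℓ} 𝒟 ≺ᶜ 2^ω-setoid →
  (∀ D → D ∈ 𝒟 → Dense D) →
  ∃[ F ] IsFilter F × (∀ D → D ∈ 𝒟 → F ≬ D)

------------------------------------------------------------------------
-- The Grinzing property

Grinzing : Pred 2^ω 0ℓ → Set₁
Grinzing W =
  Uncountable W ×
  (∀ (Y : Pred 2^ω 0ℓ) → Y ⊆ W → Uncountable Y →
    Σ (Func ω₁ (≐-setoid 2^ω 0ℓ)) λ 𝒴 →
      (∀ α → Func.to 𝒴 α ⊆ Y × Uncountable (Func.to 𝒴 α)) ×
      (∀ α β → ¬ (α ≅ β) → cl (Func.to 𝒴 α) ⊥ cl (Func.to 𝒴 β)))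

module Submission where

open import Axiom.Extensionality.Propositional using (Extensionality; lower-extensionality)
open import Axiom.UniquenessOfIdentityProofs.WithK using (uip)
open import Data.Bool.Base using (Bool; true; false; T; not; _∧_; if_then_else_)
open import Data.Bool.Properties using (T-∧; T-irrelevant; not-¬; ¬-not; _≟_)
open import Data.Empty using (⊥-elim)
open import Data.List.Base using (List; []; _∷_; _++_; map)
open import Data.List.Membership.Propositional using () renaming (_∈_ to _∈ₗ_)
open import Data.List.Membership.Propositional.Properties using (∈-++⁻; ∈-map⁺)
open import Data.List.Relation.Binary.Subset.Propositional using () renaming (_⊆_ to _⊆ₗ_)
open import Data.List.Relation.Binary.Subset.Propositional.Properties using (xs⊆xs++ys; xs⊆ys++xs)
open import Data.List.Relation.Unary.Any using (here; there)
open import Data.Nat.Base using (ℕ; suc; _+_; _*_; _<_; _⊔_)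
import Data.Nat.Induction as ℕ
import Data.Nat.Properties as ℕ
open import Data.Product.Base using (Σ; ∃-syntax; _×_; _,_; proj₁; proj₂)
open import Data.Sum.Base using (_⊎_; inj₁; inj₂)
open import Data.Unit.Base using (tt)
open import Defs
open import Function.Base using (_∘_)
open import Function.Bundles using (Equivalence; Func; Injection; Inverse)
open import Function.Definitions using (Injective)
open import Induction.WellFounded using (Acc; acc; WellFounded; WfRec; module All; module FixPoint; module Subrelation)
open import Level using (0ℓ; lift; lower)
open import Relation.Binary.Bundles using (Poset; Setoid)
import Relation.Binary.Construct.On as On
open import Relation.Binary.Core using (Rel)
open import Relation.Binary.Definitions using (Tri; tri<; tri≈; tri>; Trichotomous)
open import Relation.Binary.PropositionalEquality using (_≡_; _≢_; refl; sym; trans; cong; cong₂; subst; subst₂; isEquivalence)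
open import Relation.Binary.Structures using (IsStrictTotalOrder)
open import Relation.Binary.Structures.Biased using (isStrictTotalOrderᶜ)
open import Relation.Nullary.Decidable using (Dec; yes; no; isYes; toWitness; fromWitness; decidable-stable; map′)
open import Relation.Nullary.Negation using (¬_)
open import Relation.Unary using (Pred; U; _∈_; _⊆_; _∩_; _≐_; _≬_; _⊥_)
open import Relation.Unary.Relation.Binary.Equality using (≐-setoid)

-- Enumerate ω₁ many points y κ of Y, and fix injections e(–, μ) of the
-- predecessors of each μ < ω₁ into ω.  Let the real z μ record, at place
-- (e(κ, μ), i), the bit i of y κ, for κ < μ.  A σ-centred forcing with
-- finite conditions shows that y μ ↦ z μ is σ-continuous: there are clopen
-- sets C m j and m : ω₁ → ω such that bit j of z μ says whether y μ lies in
-- C (m μ) j.  By the pigeonhole argument behind Ulam matrices, there is one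
-- pair (n , m₀) such that, for uncountably many κ, uncountably many μ > κ
-- satisfy e(κ, μ) = n and m μ = m₀.  For these κ let Y_κ be the set of the
-- corresponding y μ.  On Y_κ, membership in C m₀ (n , i) is constantly bit i
-- of y κ, so distinct Y_κ are separated by a clopen set.

-- Pairing of natural numbers and countable predicates.

pair : ℕ → ℕ → ℕ
pair m n = (m + n) * (m + n) + m

-- As `m ≤ s` for the sum `s = m + n`, the value `s * s + m` lies below `suc s * suc s`, so
-- different sums occupy disjoint intervals between squares.
pair-<-sum : ∀ m n m′ n′ → m + n < m′ + n′ → pair m n < pair m′ n′
pair-<-sum m n m′ n′ s<s′ = begin-strict
  s * s + m           ≤⟨ ℕ.+-monoʳ-≤ (s * s) (ℕ.m≤m+n m n) ⟩
  s * s + s           ≡⟨ ℕ.+-comm (s * s) s ⟩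
  suc s * s           <⟨ ℕ.*-monoʳ-< (suc s) (ℕ.n<1+n s) ⟩
  suc s * suc s       ≤⟨ ℕ.*-mono-≤ s<s′ s<s′ ⟩
  s′ * s′             ≤⟨ ℕ.m≤m+n (s′ * s′) m′ ⟩
  s′ * s′ + m′        ∎
  where
  open ℕ.≤-Reasoning
  s = m + n
  s′ = m′ + n′

pair-injective : ∀ {m n m′ n′} → pair m n ≡ pair m′ n′ → m ≡ m′ × n ≡ n′
pair-injective {m} {n} {m′} {n′} eq with ℕ.<-cmp (m + n) (m′ + n′)
... | tri< s<s′ _ _ = ⊥-elim (ℕ.<⇒≢ (pair-<-sum m n m′ n′ s<s′) eq)
... | tri> _ _ s′<s = ⊥-elim (ℕ.<⇒≢ (pair-<-sum m′ n′ m n s′<s) (sym eq))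
... | tri≈ _ s≡s′ _ = m≡m′ , ℕ.+-cancelˡ-≡ m n n′ (trans s≡s′ (cong (_+ n′) (sym m≡m′)))
  where
  m≡m′ : m ≡ m′
  m≡m′ = ℕ.+-cancelˡ-≡ ((m + n) * (m + n)) m m′
    (trans eq (cong (λ s → s * s + m′) (sym s≡s′)))

-- The number attached to a may depend on the proof of P a.
Ctbl : {A : Set} → Pred A 0ℓ → Set
Ctbl P = Σ (∀ {a} → P a → ℕ) λ f → ∀ {a b} (p : P a) (q : P b) → f p ≡ f q → a ≡ b

Ctbl-preimage : {A B : Set} {P : Pred A 0ℓ} {R : Pred B 0ℓ} (g : A → B) →
  (∀ {a} → P a → R (g a)) → (∀ {a b} → P a → P b → g a ≡ g b → a ≡ b) → Ctbl R → Ctbl P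
Ctbl-preimage g P⇒R g-inj (f , f-inj) =
  (λ p → f (P⇒R p)) , λ p q eq → g-inj p q (f-inj (P⇒R p) (P⇒R q) eq)

Ctbl-⊆ : {A : Set} {P R : Pred A 0ℓ} → P ⊆ R → Ctbl R → Ctbl P
Ctbl-⊆ P⊆R = Ctbl-preimage (λ a → a) P⊆R (λ _ _ eq → eq)

ℕ-Ctbl : Ctbl {ℕ} U
ℕ-Ctbl = (λ {n} _ → n) , λ _ _ eq → eq

ℕ²-Ctbl : Ctbl {ℕ × ℕ} U
ℕ²-Ctbl = (λ {(m , n)} _ → pair m n) , λ _ _ eq → let p , q = pair-injective eq in cong₂ _,_ p q

-- The membership proof already names an index `k`, and the number may depend on it, so pairing the
-- two codes suffices.
Ctbl-⋃ : {K A : Set} {P : K → Pred A 0ℓ} → Ctbl {K} U → (∀ k → Ctbl (P k)) → Ctbl (λ a → ∃[ k ] P k a)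
Ctbl-⋃ {K} {A} {P} (code , code-inj) c = f , f-inj
  where
  f : ∀ {a} → ∃[ k ] P k a → ℕ
  f (k , p) = pair (code {k} tt) (proj₁ (c k) p)

  f-inj : ∀ {a b} (p : ∃[ k ] P k a) (q : ∃[ k ] P k b) → f p ≡ f q → a ≡ b
  f-inj (k , p) (l , q) eq with pair-injective eq
  ... | k≡l , eq′ with code-inj {k} {l} tt tt k≡l
  ...   | refl = proj₂ (c k) p q eq′

-- Countable ordinals

open CountableOrdinal using (Element)

<ₑ-syntax : (α : CountableOrdinal) → Element α → Element α → Set
<ₑ-syntax = CountableOrdinal._<ₑ_

infix 4 <ₑ-syntax
syntax <ₑ-syntax α x y = x <[ α ] y

Element-≡ : ∀ α {x y : Element α} → proj₁ x ≡ proj₁ y → x ≡ y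
Element-≡ α refl = cong (_ ,_) (T-irrelevant _ _)

<ₑ-irrefl : ∀ α {x} → ¬ x <[ α ] x
<ₑ-irrefl α {x} = IsStrictTotalOrder.irrefl (CountableOrdinal.isStrictTotalOrder α) {x} {x} refl

<ₑ-trans : ∀ α {x y z} → x <[ α ] y → y <[ α ] z → x <[ α ] z
<ₑ-trans α {x} {y} {z} =
  IsStrictTotalOrder.trans (CountableOrdinal.isStrictTotalOrder α) {x} {y} {z}

<ₑ-compare : ∀ α x y → Tri (x <[ α ] y) (proj₁ x ≡ proj₁ y) (y <[ α ] x)
<ₑ-compare α = IsStrictTotalOrder.compare (CountableOrdinal.isStrictTotalOrder α)

infixl 8 _↓_

module _ (α : CountableOrdinal) (x : Element α) where
  open CountableOrdinal α using (dom; lt)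

  ↓-dom : ℕ → Bool
  ↓-dom m = dom m ∧ lt m (proj₁ x)

  include : Σ ℕ (T ∘ ↓-dom) → Element α
  include (m , t) = m , proj₁ (Equivalence.to (T-∧ {dom m}) t)

  include-< : ∀ u → include u <[ α ] x
  include-< (m , t) = proj₂ (Equivalence.to (T-∧ {dom m}) t)

  restrict : ∀ u → u <[ α ] x → Σ ℕ (T ∘ ↓-dom)
  restrict (m , t) m<x = m , Equivalence.from (T-∧ {dom m}) (t , m<x)

-- The initial segment of `α` strictly below `x`. It keeps the numbers and the relation `lt` of `α`,
-- so the order axioms pull back along `include`.
_↓_ : (α : CountableOrdinal) → Element α → CountableOrdinal
α ↓ x = record
  { dom                = ↓-dom α x
  ; lt                 = CountableOrdinal.lt α
  ; isStrictTotalOrder = On.isStrictTotalOrder (include α x) (CountableOrdinal.isStrictTotalOrder α)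
  ; wellFounded        = On.wellFounded (include α x) (CountableOrdinal.wellFounded α)
  }

-- Trichotomy on `α` makes a strictly increasing map injective and its inverse increasing.
monotone-surjection⇒≅ : ∀ α β (f : Element α → Element β) →
  (∀ x y → x <[ α ] y → f x <[ β ] f y) →
  (∀ y → ∃[ x ] f x ≡ y) → α ≅ β
monotone-surjection⇒≅ α β f mono surj = record
  { bijection = record
    { to        = f
    ; from      = λ y → proj₁ (surj y)
    ; to-cong   = λ eq → cong (proj₁ ∘ f) (Element-≡ α eq)
    ; from-cong = λ eq → cong (proj₁ ∘ proj₁ ∘ surj) (Element-≡ β eq)
    ; inverse   = (λ {y} eq → trans (cong (proj₁ ∘ f) (Element-≡ α eq)) (cong proj₁ (proj₂ (surj y))))
                , (λ {x} eq → injective _ x (trans (proj₂ (surj _)) (Element-≡ β eq)))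
    }
  ; to-mono   = λ {x} {y} → mono x y
  ; from-mono = λ {x} {y} → reflects x y
  }
  where
  injective : ∀ x x′ → f x ≡ f x′ → proj₁ x ≡ proj₁ x′
  injective x x′ eq with <ₑ-compare α x x′
  ... | tri< x<x′ _ _ = ⊥-elim (<ₑ-irrefl β {f x′} (subst (λ y → y <[ β ] f x′) eq (mono x x′ x<x′)))
  ... | tri≈ _ x≡x′ _ = x≡x′
  ... | tri> _ _ x′<x = ⊥-elim (<ₑ-irrefl β {f x′} (subst (λ y → f x′ <[ β ] y) eq (mono x′ x x′<x)))

  reflects : ∀ y y′ → y <[ β ] y′ → proj₁ (surj y) <[ α ] proj₁ (surj y′)
  reflects y y′ y<y′ with surj y | surj y′
  ... | x , refl | x′ , refl with <ₑ-compare α x x′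
  ...   | tri< x<x′ _ _ = x<x′
  ...   | tri≈ _ x≡x′ _ = ⊥-elim (<ₑ-irrefl β {f x′}
            (subst (λ z → f z <[ β ] f x′) (Element-≡ α {x} {x′} x≡x′) y<y′))
  ...   | tri> _ _ x′<x = ⊥-elim (<ₑ-irrefl β {f x} (<ₑ-trans β {f x} {f x′} {f x} y<y′ (mono x′ x x′<x)))

to∘from : ∀ {α β} (f : α ≅ β) y → _≅_.to f (_≅_.from f y) ≡ y
to∘from {β = β} f y = Element-≡ β (Inverse.inverseˡ (_≅_.bijection f) refl)

↓-↓ : ∀ α x u → (α ↓ x) ↓ u ≅ α ↓ include α x u
↓-↓ α x u = monotone-surjection⇒≅ ((α ↓ x) ↓ u) (α ↓ u′)
  (λ v → restrict α u′ (include α x (include (α ↓ x) u v)) (include-< (α ↓ x) u v))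
  (λ _ _ v<w → v<w)
  λ v → restrict (α ↓ x) u
          (restrict α x (include α u′ v) (<ₑ-trans α {include α u′ v} {u′} {x} (include-< α u′ v) (include-< α x u)))
          (include-< α u′ v)
      , Element-≡ (α ↓ u′) refl
  where u′ = include α x u

↓-cong : ∀ α β (f : α ≅ β) x → α ↓ x ≅ β ↓ _≅_.to f x
↓-cong α β f x = monotone-surjection⇒≅ (α ↓ x) (β ↓ to x)
  (λ u → restrict β (to x) (to (include α x u)) (to-mono (include-< α x u)))
  (λ _ _ u<v → to-mono u<v)
  λ v → restrict α x (from (include β (to x) v))
          (subst (λ z → from (include β (to x) v) <[ α ] z) (from∘to x)
            (from-mono {include β (to x) v} {to x} (include-< β (to x) v)))
      , Element-≡ (β ↓ to x) (trans (cong (proj₁ ∘ to) (Element-≡ α refl)) (cong proj₁ (to∘from f (include β (to x) v))))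
  where
  open _≅_ f

  from∘to : ∀ y → from (to y) ≡ y
  from∘to y = to∘from (≅-sym f) y

-- A strictly increasing self-map never moves a point down: otherwise its iterates descend forever.
increasing⇒inflationary : ∀ α (f : Element α → Element α) →
  (∀ x y → x <[ α ] y → f x <[ α ] f y) → ∀ x → ¬ f x <[ α ] x
increasing⇒inflationary α f mono x = go x (CountableOrdinal.wellFounded α x)
  where
  go : ∀ x → Acc (<ₑ-syntax α) x → ¬ f x <[ α ] x
  go x (acc rs) fx<x = go (f x) (rs fx<x) (mono (f x) x fx<x)

-- Followed by `include`, such an isomorphism would be a strictly increasing self-map of `α` that
-- moves `x` down.
≇-↓ : ∀ α x → ¬ α ≅ α ↓ x
≇-↓ α x f = increasing⇒inflationary α (include α x ∘ _≅_.to f) (λ _ _ → _≅_.to-mono f) x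
  (include-< α x (_≅_.to f x))

-- If `x` were below `y`, then `α ↓ x` would be a proper segment of `α ↓ y` and isomorphic to it.
↓-injective : ∀ α x y → α ↓ x ≅ α ↓ y → x ≡ y
↓-injective α x y f with <ₑ-compare α x y
... | tri< x<y _ _ = ⊥-elim (≇-↓ (α ↓ y) (restrict α y x x<y)
        (≅-trans (≅-sym f) (≅-sym (↓-↓ α y (restrict α y x x<y)))))
... | tri≈ _ x≡y _ = Element-≡ α x≡y
... | tri> _ _ y<x = ⊥-elim (≇-↓ (α ↓ x) (restrict α x y y<x)
        (≅-trans f (≅-sym (↓-↓ α x (restrict α x y y<x)))))

infix 4 _<ₒ_

record _<ₒ_ (α β : CountableOrdinal) : Set where
  constructor below
  field
    bound : Element β
    iso   : α ≅ β ↓ bound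

open _<ₒ_ public

↓-<ₒ : ∀ α x → α ↓ x <ₒ α
↓-<ₒ α x = below x ≅-refl

<ₒ-respˡ : ∀ {α β γ} → α ≅ β → β <ₒ γ → α <ₒ γ
<ₒ-respˡ f (below x g) = below x (≅-trans f g)

<ₒ-respʳ : ∀ {α β γ} → α <ₒ β → β ≅ γ → α <ₒ γ
<ₒ-respʳ {β = β} {γ} (below x f) g = below (_≅_.to g x) (≅-trans f (↓-cong β γ g x))

<ₒ-trans : ∀ {α β γ} → α <ₒ β → β <ₒ γ → α <ₒ γ
<ₒ-trans {β = β} {γ} (below x f) (below y g) = below (include γ y (_≅_.to g x))
  (≅-trans f (≅-trans (↓-cong β (γ ↓ y) g x) (↓-↓ γ y (_≅_.to g x))))

<ₒ-irrefl : ∀ {α β} → α ≅ β → ¬ α <ₒ β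
<ₒ-irrefl {β = β} f (below x g) = ≇-↓ β x (≅-trans (≅-sym f) g)

-- Below `α` there are only copies of segments `α ↓ x`, so accessibility of `x` inside `α` transfers
-- to them.
<ₒ-wellFounded : WellFounded _<ₒ_
<ₒ-wellFounded α = acc λ (below x f) → segment x (CountableOrdinal.wellFounded α x) f
  where
  segment : ∀ x → Acc (<ₑ-syntax α) x → ∀ {γ} → γ ≅ α ↓ x → Acc _<ₒ_ γ
  segment x (acc rs) f = acc λ γ′<γ →
    let below u g = <ₒ-respʳ γ′<γ f
    in segment (include α x u) (rs (include-< α x u)) (≅-trans g (↓-↓ α x u))

-- Each `x` goes to the point of `β` that cuts off a copy of `α ↓ x`. That point is unique by
-- `↓-injective`, which gives monotonicity; the second hypothesis gives surjectivity.
matching-segments⇒≅ : ∀ α β → (∀ x → α ↓ x <ₒ β) → (∀ y → β ↓ y <ₒ α) → α ≅ β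
matching-segments⇒≅ α β fwd bwd = monotone-surjection⇒≅ α β f mono surj
  where
  f : Element α → Element β
  f x = bound (fwd x)

  mono : ∀ x′ x → x′ <[ α ] x → f x′ <[ β ] f x
  mono x′ x x′<x = subst (λ y → y <[ β ] f x) (sym fx′≡u) (include-< β (f x) (bound r))
    where
    r : α ↓ x′ <ₒ β ↓ f x
    r = <ₒ-respʳ (below (restrict α x x′ x′<x) (≅-sym (↓-↓ α x (restrict α x x′ x′<x)))) (iso (fwd x))

    fx′≡u : f x′ ≡ include β (f x) (bound r)
    fx′≡u = ↓-injective β _ _
      (≅-trans (≅-sym (iso (fwd x′))) (≅-trans (iso r) (↓-↓ β (f x) (bound r))))

  surj : ∀ y → ∃[ x ] f x ≡ y
  surj y = let below x g = bwd y in
    x , ↓-injective β _ _ (≅-trans (≅-sym (iso (fwd x))) (≅-sym g))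

-- Induction along `_<ₒ_` yields `α ≅ μ ↓ index α` for every `α`; the case of `μ` itself contradicts
-- `≇-↓`.
no-universal-ordinal : ∀ μ (index : CountableOrdinal → Element μ) →
  (∀ {α β} → α <ₒ β → index α <[ μ ] index β) →
  ¬ (∀ α y → y <[ μ ] index α → ∃[ x ] index (α ↓ x) ≡ y)
no-universal-ordinal μ index index-mono index-initial = ≇-↓ μ (index μ) (segment μ (<ₒ-wellFounded μ))
  where
  segment : ∀ α → Acc _<ₒ_ α → α ≅ μ ↓ index α
  segment α (acc rs) = matching-segments⇒≅ α (μ ↓ index α) fwd bwd
    where
    initial : ∀ x → Element (μ ↓ index α)
    initial x = restrict μ (index α) (index (α ↓ x)) (index-mono (↓-<ₒ α x))

    agree : ∀ x → α ↓ x ≅ (μ ↓ index α) ↓ initial x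
    agree x = ≅-trans (segment (α ↓ x) (rs (↓-<ₒ α x)))
      (≅-trans (subst (λ y → μ ↓ index (α ↓ x) ≅ μ ↓ y)
        (Element-≡ μ {index (α ↓ x)} {include μ (index α) (initial x)} refl) ≅-refl)
        (≅-sym (↓-↓ μ (index α) (initial x))))

    fwd : ∀ x → α ↓ x <ₒ μ ↓ index α
    fwd x = below (initial x) (agree x)

    bwd : ∀ y → (μ ↓ index α) ↓ y <ₒ α
    bwd y with index-initial α (include μ (index α) y) (include-< μ (index α) y)
    ... | x , eq = below x
      (subst (λ z → (μ ↓ index α) ↓ z ≅ α ↓ x) (Element-≡ (μ ↓ index α) {initial x} {y} (cong proj₁ eq))
        (≅-sym (agree x)))

-- Clopen sets

-- Decision trees: every clopen subset of 2^ω is { x ∣ eval t x ≡ true } for some t.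
data Tree : Set where
  leaf : Bool → Tree
  node : ℕ → Tree → Tree → Tree

eval : Tree → 2^ω → Bool
eval (leaf b)     x = b
eval (node k t u) x = if x k then eval t x else eval u x

-- A tree queries finitely many bits, and `n` exceeds the positions of all of them.
eval-local : ∀ t → ∃[ n ] ∀ {x y} → cylinder n x y → eval t y ≡ eval t x
eval-local (leaf b) = 0 , λ _ → refl
-- The successor of `k`, because `cylinder n x` fixes only the bits strictly below `n`.
eval-local (node k t u) = suc k ⊔ (m ⊔ n) , local
  where
  m = proj₁ (eval-local t)
  n = proj₁ (eval-local u)
  m≤ = ℕ.≤-trans (ℕ.m≤m⊔n m n) (ℕ.m≤n⊔m (suc k) (m ⊔ n))
  n≤ = ℕ.≤-trans (ℕ.m≤n⊔m m n) (ℕ.m≤n⊔m (suc k) (m ⊔ n))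

  local : ∀ {x y} → cylinder (suc k ⊔ (m ⊔ n)) x y → eval (node k t u) y ≡ eval (node k t u) x
  local {x} {y} agree
    rewrite agree k (ℕ.m≤m⊔n (suc k) (m ⊔ n))
          | proj₂ (eval-local t) {x} {y} (λ i i<m → agree i (ℕ.<-≤-trans i<m m≤))
          | proj₂ (eval-local u) {x} {y} (λ i i<n → agree i (ℕ.<-≤-trans i<n n≤)) = refl

-- Orders the branches so that `t` serves the points whose bit `k` is `b`, and `u` the others.
split : ℕ → Bool → Tree → Tree → Tree
split k true  t u = node k t u
split k false t u = node k u t

eval-split-≡ : ∀ k b t u {x} → x k ≡ b → eval (split k b t u) x ≡ eval t x
eval-split-≡ k true  t u eq rewrite eq = refl
eval-split-≡ k false t u eq rewrite eq = refl

eval-split-≢ : ∀ k b t u {x} → x k ≢ b → eval (split k b t u) x ≡ eval u x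
eval-split-≢ k true  t u neq rewrite ¬-not neq = refl
eval-split-≢ k false t u neq rewrite ¬-not neq = refl

Decodes : (ℕ → Tree) → Pred 2^ω 0ℓ → 2^ω → Set
Decodes t A a = ∀ {x} → x ∈ A → ∀ i → eval (t i) x ≡ a i

-- Each equation `eval (t i) x ≡ a i` defines a clopen set of points `x`, so it passes from `A` to
-- the closure.
cl-decodes : ∀ t {A a} → Decodes t A a → Decodes t (cl A) a
cl-decodes t decodes x∈cl i =
  let n , local = eval-local (t i)
      _ , near , w∈A = x∈cl n
  in trans (sym (local near)) (decodes w∈A i)

-- The tag `0` marks leaves and `suc k` marks nodes, so the two kinds cannot collide.
tree-code : Tree → ℕ
tree-code (leaf false) = pair 0 0
tree-code (leaf true)  = pair 0 1
tree-code (node k t u) = pair (suc k) (pair (tree-code t) (tree-code u))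

tree-code-injective : ∀ t u → tree-code t ≡ tree-code u → t ≡ u
tree-code-injective (leaf false) (leaf false) eq = refl
tree-code-injective (leaf true) (leaf true) eq = refl
tree-code-injective (leaf false) (leaf true) eq with () ← proj₂ (pair-injective {0} {0} {0} {1} eq)
tree-code-injective (leaf true) (leaf false) eq with () ← proj₂ (pair-injective {0} {1} {0} {0} eq)
tree-code-injective (leaf false) (node k t u) eq with () ← proj₁ (pair-injective {0} {0} {suc k} eq)
tree-code-injective (leaf true) (node k t u) eq with () ← proj₁ (pair-injective {0} {1} {suc k} eq)
tree-code-injective (node k t u) (leaf false) eq with () ← proj₁ (pair-injective {suc k} {_} {0} {0} eq)
tree-code-injective (node k t u) (leaf true) eq with () ← proj₁ (pair-injective {suc k} {_} {0} {1} eq)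
tree-code-injective (node k t u) (node k′ t′ u′) eq with pair-injective {suc k} {_} {suc k′} eq
... | refl , eq′ with pair-injective {tree-code t} {_} {tree-code t′} eq′
...   | p , q with tree-code-injective t t′ p | tree-code-injective u u′ q
...     | refl | refl = refl

stem-code : List (ℕ × ℕ × Tree) → ℕ
stem-code []                = 0
stem-code ((m , j , t) ∷ s) = suc (pair (pair m j) (pair (tree-code t) (stem-code s)))

stem-code-injective : ∀ r s → stem-code r ≡ stem-code s → r ≡ s
stem-code-injective []      []      eq = refl
stem-code-injective ((m , j , t) ∷ r) ((m′ , j′ , t′) ∷ s) eq
  with p , q ← pair-injective {pair m j} {_} {pair m′ j′} (ℕ.suc-injective eq)
  with refl , refl ← pair-injective {m} {j} {m′} {j′} p
  with q₁ , q₂ ← pair-injective {tree-code t} {_} {tree-code t′} q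
  with refl ← tree-code-injective t t′ q₁ | refl ← stem-code-injective r s q₂ = refl

unused : (s : List (ℕ × ℕ × Tree)) → ∃[ n ] ∀ {m j t} → (m , j , t) ∈ₗ s → m < n
unused []                = 0 , λ ()
unused ((m , _ , _) ∷ s) = suc m ⊔ proj₁ (unused s) , λ
  { (here refl) → ℕ.m≤m⊔n (suc m) (proj₁ (unused s))
  ; (there e∈s) → ℕ.<-≤-trans (proj₂ (unused s) e∈s) (ℕ.m≤n⊔m (suc m) (proj₁ (unused s)))
  }

-- Consequences of excluded middle and extensionality: choice, representatives, uncountability.

module Classically (em : ∀ {P : Set} → Dec P) (ext : Extensionality 0ℓ 0ℓ) where
  ¬∀⇒∃¬ : {A : Set} {P : Pred A 0ℓ} → ¬ (∀ a → P a) → ∃[ a ] ¬ P a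
  ¬∀⇒∃¬ ¬∀ = decidable-stable em λ ¬∃ →
    ¬∀ λ a → decidable-stable em λ ¬p → ¬∃ (a , ¬p)

  -- Otherwise every colour class would be countable, and so would their union `P`.
  pigeonhole : {K A : Set} {P : Pred A 0ℓ} → Ctbl {K} U → (c : A → K) → ¬ Ctbl P →
    ∃[ k ] ¬ Ctbl (λ a → P a × c a ≡ k)
  pigeonhole K-ctbl c ¬ctbl = ¬∀⇒∃¬ λ ctbl →
    ¬ctbl (Ctbl-⊆ (λ {a} p → c a , p , refl) (Ctbl-⋃ K-ctbl ctbl))

  -- The witness supplied by `em` depends on `X` alone, so this function is constant: it chooses one
  -- element of each inhabited type.
  canonical : {X : Set} → X → X
  canonical {X} x with em {X}
  ... | yes y = y
  ... | no _  = x

  canonical-constant : {X : Set} (x y : X) → canonical x ≡ canonical y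
  canonical-constant {X} x y with em {X}
  ... | yes _ = refl
  ... | no ¬x = ⊥-elim (¬x x)

  Uncountable⇒¬Ctbl : {Y : Pred 2^ω 0ℓ} → Uncountable Y → ¬ Ctbl Y
  Uncountable⇒¬Ctbl {Y} unc (f , f-inj) = unc record
    -- An `Injection` must respect equality of points, so the dependence on the membership proof is
    -- removed by `canonical`.
    { to        = λ (_ , y∈Y) → f (canonical y∈Y)
    ; cong      = λ { {_ , y∈Y} {_ , z∈Y} y≈z → f-cong y∈Y z∈Y (ext y≈z) }
    ; injective = λ eq k → cong (λ y → y k) (f-inj _ _ eq)
    }
    where
    f-cong : ∀ {y z} (y∈Y : Y y) (z∈Y : Y z) → y ≡ z → f (canonical y∈Y) ≡ f (canonical z∈Y)
    f-cong y∈Y z∈Y refl = cong f (canonical-constant y∈Y z∈Y)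

  ¬Ctbl⇒Uncountable : {Y : Pred 2^ω 0ℓ} → ¬ Ctbl Y → Uncountable Y
  ¬Ctbl⇒Uncountable ¬ctbl inj = ¬ctbl
    ( (λ {y} y∈Y → Injection.to inj (y , y∈Y))
    , λ _ _ eq → ext (Injection.injective inj eq) )

  -- Cantor's diagonal argument: `d` flips bit `n` of the point numbered `n`, if there is one.
  2^ω-¬Ctbl : ¬ Ctbl {2^ω} U
  2^ω-¬Ctbl (f , f-inj) = differs em refl
    where
    flip : ∀ n → Dec (Σ 2^ω λ x → f {x} tt ≡ n) → Bool
    flip n (yes (x , _)) = not (x n)
    flip n (no _)        = false

    d : 2^ω
    d n = flip n em

    differs : (d∈ : Dec (Σ 2^ω λ x → f {x} tt ≡ f {d} tt)) → flip (f {d} tt) d∈ ≢ d (f {d} tt)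
    differs (yes (x , fx≡fd)) eq = not-¬ (cong (λ y → y (f {d} tt)) (sym (f-inj {x} {d} tt tt fx≡fd))) (sym eq)
    differs (no ¬∃)           _  = ¬∃ (d , refl)

  module _ (S : Setoid 0ℓ 0ℓ) where
    open Setoid S using (_≈_) renaming (Carrier to A; refl to ≈-refl; sym to ≈-sym; trans to ≈-trans)

    private
      -- Boolean characteristic functions of classes: by extensionality those of equivalent points
      -- are equal, so `canonical` chooses the same representative for both.
      χ : A → A → Bool
      χ x y = isYes (em {x ≈ y})

      pick : (φ : A → Bool) → Σ A (T ∘ φ) → A
      pick φ s = proj₁ (canonical s)

      pick-cong : ∀ {φ ψ} → φ ≡ ψ → (s : Σ A (T ∘ φ)) (t : Σ A (T ∘ ψ)) → pick φ s ≡ pick ψ t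
      pick-cong refl s t = cong proj₁ (canonical-constant s t)

      χ-self : ∀ x → Σ A (T ∘ χ x)
      χ-self x = x , fromWitness {a? = em} ≈-refl

    abstract
      canon : A → A
      canon x = pick (χ x) (χ-self x)

      canon-≈ : ∀ x → x ≈ canon x
      canon-≈ x = toWitness {a? = em} (proj₂ (canonical (χ-self x)))

      canon-cong : ∀ {x y} → x ≈ y → canon x ≡ canon y
      canon-cong {x} {y} x≈y = pick-cong (ext χ≡) (χ-self x) (χ-self y)
        where
        χ≡ : ∀ z → χ x z ≡ χ y z
        χ≡ z with em {x ≈ z} | em {y ≈ z}
        ... | yes _   | yes _   = refl
        ... | no _    | no _    = refl
        ... | yes x≈z | no y≉z  = ⊥-elim (y≉z (≈-trans (≈-sym x≈y) x≈z))
        ... | no x≉z  | yes y≈z = ⊥-elim (x≉z (≈-trans x≈y y≈z))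

    canon-injective : ∀ {x y} → canon x ≡ canon y → x ≈ y
    canon-injective {x} {y} eq = ≈-trans (canon-≈ x) (subst (_≈ y) (sym eq) (≈-sym (canon-≈ y)))

  -- The Cantor-Schröder-Bernstein theorem.

  module _ {A B : Set} {f : A → B} {g : B → A}
    (f-inj : Injective _≡_ _≡_ f) (g-inj : Injective _≡_ _≡_ g) where

    private
      -- The points of A whose backward orbit under f and g stops in A.
      data Chain : Pred A 0ℓ where
        start : ∀ {a} → (∀ b → g b ≢ a) → Chain a
        step  : ∀ {a} → Chain a → Chain (g (f a))

      data Graph (a : A) : B → Set where
        forth : Chain a → Graph a (f a)
        back  : ∀ {b} → ¬ Chain a → g b ≡ a → Graph a b

      total : ∀ a → ∃[ b ] Graph a b
      total a with em {Chain a}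
      ... | yes c = f a , forth c
      ... | no ¬c with em {∃[ b ] g b ≡ a}
      ...   | yes (b , gb≡a) = b , back ¬c gb≡a
      ...   | no ¬∃          = ⊥-elim (¬c (start λ b gb≡a → ¬∃ (b , gb≡a)))

      functional : ∀ {a b b′} → Graph a b → Graph a b′ → b ≡ b′
      functional (forth _)   (forth _)   = refl
      functional (forth c)   (back ¬c _) = ⊥-elim (¬c c)
      functional (back ¬c _) (forth c)   = ⊥-elim (¬c c)
      functional (back _ p)  (back _ q)  = g-inj (trans p (sym q))

      forth≢back : ∀ {a a′} → Chain a → ¬ Chain a′ → g (f a) ≢ a′
      forth≢back c ¬c refl = ¬c (step c)

      injective : ∀ {a a′ b b′} → b ≡ b′ → Graph a b → Graph a′ b′ → a ≡ a′
      injective eq (forth _)    (forth _)    = f-inj eq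
      injective eq (forth c)    (back ¬c q)  = ⊥-elim (forth≢back c ¬c (trans (cong g eq) q))
      injective eq (back ¬c p)  (forth c)    = ⊥-elim (forth≢back c ¬c (trans (cong g (sym eq)) p))
      injective eq (back _ p)   (back _ q)   = trans (sym p) (trans (cong g eq) q)

      -- A chain cannot start in the range of `g`, so its last step passed through `b`.
      unstep : ∀ {a b} → Chain a → g b ≡ a → ∃[ a′ ] Graph a′ b
      unstep (start ¬∃) p = ⊥-elim (¬∃ _ p)
      unstep (step {a} c) p = a , subst (Graph a) (g-inj (sym p)) (forth c)

      onto : ∀ b → ∃[ a ] Graph a b
      onto b with em {Chain (g b)}
      ... | yes c = unstep c refl
      ... | no ¬c = g b , back ¬c refl

    cantor-schröder-bernstein : Σ (A → B) λ h → Injective _≡_ _≡_ h × (∀ b → ∃[ a ] h a ≡ b)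
    cantor-schröder-bernstein =
        (λ a → proj₁ (total a))
      , (λ eq → injective eq (proj₂ (total _)) (proj₂ (total _)))
      , λ b → let (a , Gab) = onto b in a , functional (proj₂ (total a)) Gab

  -- Transfinite selection of distinct points from an uncountable set.

  module _ {P S : Set} {_⊏_ : Rel P 0ℓ} (⊏-wf : WellFounded _⊏_) (initial : ∀ p → Ctbl (_⊏ p))
           {A : Pred S 0ℓ} (A-¬ctbl : ¬ Ctbl A) where
    private
      -- If the values at predecessors of `p` exhausted `A`, numbering the predecessors would number
      -- `A`. Through `canonical` each predecessor contributes a single value.
      fresh : ∀ p (f : ∀ q → q ⊏ p → S) →
        ∃[ s ] A s × (∀ q (q⊏p : q ⊏ p) → f q (canonical q⊏p) ≢ s)
      fresh p f = decidable-stable em λ ¬fresh →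
        let hit : ∀ {s} → A s → ∃[ q ] Σ (q ⊏ p) λ q⊏p → f q (canonical q⊏p) ≡ s
            hit s∈A = decidable-stable em λ ¬hit →
              ¬fresh (_ , s∈A , λ q q⊏p eq → ¬hit (q , q⊏p , eq))
        in A-¬ctbl
          ( (λ s∈A → proj₁ (initial p) (proj₁ (proj₂ (hit s∈A))))
          , λ s∈A t∈A eq → same (hit s∈A) (hit t∈A) eq )
        where
        same : ∀ {s t} (h : ∃[ q ] Σ (q ⊏ p) λ q⊏p → f q (canonical q⊏p) ≡ s)
                       (k : ∃[ q ] Σ (q ⊏ p) λ q⊏p → f q (canonical q⊏p) ≡ t) →
               proj₁ (initial p) (proj₁ (proj₂ h)) ≡ proj₁ (initial p) (proj₁ (proj₂ k)) → s ≡ t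
        same (q , q⊏p , refl) (r , r⊏p , refl) eq with proj₂ (initial p) q⊏p r⊏p eq
        ... | refl = cong (f q) (canonical-constant q⊏p r⊏p)

      next : ∀ p → WfRec _⊏_ (λ _ → S) p → S
      next p ih = proj₁ (fresh p λ q q⊏p → ih q⊏p)

      module Rec = FixPoint ⊏-wf (λ _ → S) next
        (λ p eq → cong (proj₁ ∘ fresh p) (ext λ q → ext λ q⊏p → eq q⊏p))

    abstract
      greedy : P → S
      greedy = All.wfRec ⊏-wf 0ℓ (λ _ → S) next

      private
        greedy-unfold : ∀ p → greedy p ≡ proj₁ (fresh p λ q _ → greedy q)
        greedy-unfold p = Rec.unfold-wfRec

    greedy-∈ : ∀ p → A (greedy p)
    greedy-∈ p = subst A (sym (greedy-unfold p)) (proj₁ (proj₂ (fresh p _)))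

    greedy-≢ : ∀ {q p} → q ⊏ p → greedy q ≢ greedy p
    greedy-≢ {q} {p} q⊏p eq = proj₂ (proj₂ (fresh p _)) q q⊏p (trans eq (greedy-unfold p))

    greedy-injective : Trichotomous _≡_ _⊏_ → Injective _≡_ _≡_ greedy
    greedy-injective compare {p} {q} eq with compare p q
    ... | tri< p⊏q _ _ = ⊥-elim (greedy-≢ p⊏q eq)
    ... | tri≈ _ p≡q _ = p≡q
    ... | tri> _ _ q⊏p = ⊥-elim (greedy-≢ q⊏p (sym eq))

  -- Comparability of countable ordinals and the set of their order types.

  <ₒ-connex : ∀ α → Acc _<ₒ_ α → ∀ β → Acc _<ₒ_ β → α <ₒ β ⊎ α ≅ β ⊎ β <ₒ α
  <ₒ-connex α a@(acc r) β b@(acc s)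
    with em {∃[ x ] (α ↓ x ≅ β ⊎ β <ₒ α ↓ x)} | em {∃[ y ] (α <ₒ β ↓ y ⊎ α ≅ β ↓ y)}
  ... | yes (x , inj₁ f) | _                = inj₂ (inj₂ (below x (≅-sym f)))
  ... | yes (x , inj₂ l) | _                = inj₂ (inj₂ (<ₒ-trans l (↓-<ₒ α x)))
  ... | no _             | yes (y , inj₁ l) = inj₁ (<ₒ-trans l (↓-<ₒ β y))
  ... | no _             | yes (y , inj₂ f) = inj₁ (below y f)
  -- Neither ordinal is at most a proper segment of the other, so by induction every segment of each
  -- lies below the other.
  ... | no ¬β≤α↓         | no ¬α≤β↓         = inj₂ (inj₁ (matching-segments⇒≅ α β fwd bwd))
    where
    fwd : ∀ x → α ↓ x <ₒ β
    fwd x with <ₒ-connex (α ↓ x) (r (↓-<ₒ α x)) β b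
    ... | inj₁ l        = l
    ... | inj₂ (inj₁ f) = ⊥-elim (¬β≤α↓ (x , inj₁ f))
    ... | inj₂ (inj₂ l) = ⊥-elim (¬β≤α↓ (x , inj₂ l))

    bwd : ∀ y → β ↓ y <ₒ α
    bwd y with <ₒ-connex α a (β ↓ y) (s (↓-<ₒ β y))
    ... | inj₁ l        = ⊥-elim (¬α≤β↓ (y , inj₁ l))
    ... | inj₂ (inj₁ f) = ⊥-elim (¬α≤β↓ (y , inj₂ f))
    ... | inj₂ (inj₂ l) = l

  -- One representative per order type, so that on this copy of `ω₁` isomorphism becomes
  -- propositional equality.
  Ω : Set
  Ω = ∃[ α ] canon ω₁ α ≡ α

  ordinal : Ω → CountableOrdinal
  ordinal = proj₁

  type : CountableOrdinal → Ω
  type α = canon ω₁ α , sym (canon-cong ω₁ (canon-≈ ω₁ α))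

  ordinal-type : ∀ α → α ≅ ordinal (type α)
  ordinal-type = canon-≈ ω₁

  ordinal-injective : ∀ {κ μ} → ordinal κ ≅ ordinal μ → κ ≡ μ
  ordinal-injective {κ , κ-canon} {μ , μ-canon} f
    with trans (sym κ-canon) (trans (canon-cong ω₁ f) μ-canon)
  ... | refl with κ-canon | μ-canon
  ...   | p | q = cong (κ ,_) (uip p q)

  type-cong : ∀ {α β} → α ≅ β → type α ≡ type β
  type-cong {α} {β} f = ordinal-injective (≅-trans (≅-sym (ordinal-type α)) (≅-trans f (ordinal-type β)))

  type-ordinal : ∀ κ → type (ordinal κ) ≡ κ
  type-ordinal κ = ordinal-injective (≅-sym (ordinal-type (ordinal κ)))

  infix 4 _<Ω_

  _<Ω_ : Rel Ω 0ℓ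
  κ <Ω μ = ordinal κ <ₒ ordinal μ

  <Ω-wellFounded : WellFounded _<Ω_
  <Ω-wellFounded = On.wellFounded ordinal <ₒ-wellFounded

  <Ω-compare : Trichotomous _≡_ _<Ω_
  <Ω-compare κ μ with <ₒ-connex (ordinal κ) (<ₒ-wellFounded _) (ordinal μ) (<ₒ-wellFounded _)
  ... | inj₁ κ<μ        = tri< κ<μ (λ { refl → <ₒ-irrefl ≅-refl κ<μ })
                               (λ μ<κ → <ₒ-irrefl ≅-refl (<ₒ-trans κ<μ μ<κ))
  ... | inj₂ (inj₁ f)   = tri≈ (<ₒ-irrefl f) (ordinal-injective f) (<ₒ-irrefl (≅-sym f))
  ... | inj₂ (inj₂ μ<κ) = tri> (λ κ<μ → <ₒ-irrefl ≅-refl (<ₒ-trans κ<μ μ<κ))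
                               (λ { refl → <ₒ-irrefl ≅-refl μ<κ }) μ<κ

  -- A predecessor is determined by its bound in `ordinal κ`, and bounds are natural numbers.
  <Ω-initial-Ctbl : ∀ κ → Ctbl (_<Ω κ)
  <Ω-initial-Ctbl κ = (λ (below x _) → proj₁ x) , λ (below x f) (below y g) eq → ordinal-injective
    (≅-trans f (≅-trans
      (subst (λ z → ordinal κ ↓ x ≅ ordinal κ ↓ z) (Element-≡ (ordinal κ) {x} {y} eq) ≅-refl)
      (≅-sym g)))

  -- Burali-Forti: an enumeration of Ω by natural numbers would make Ω itself a countable ordinal.
  Ω-¬Ctbl : ¬ Ctbl {Ω} U
  Ω-¬Ctbl (f , f-inj) = no-universal-ordinal ∞ (index ∘ type) index-mono index-initial
    where
    code : Ω → ℕ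
    code κ = f {κ} tt

    Dom : Pred ℕ 0ℓ
    Dom n = ∃[ κ ] code κ ≡ n

    Lt : Rel ℕ 0ℓ
    Lt m n = ∃[ κ ] ∃[ μ ] code κ ≡ m × code μ ≡ n × κ <Ω μ

    E : Set
    E = Σ ℕ λ n → T (isYes (em {Dom n}))

    decode : E → Ω
    decode (n , t) = proj₁ (toWitness {a? = em {Dom n}} t)

    code-decode : ∀ x → code (decode x) ≡ proj₁ x
    code-decode (n , t) = proj₂ (toWitness {a? = em {Dom n}} t)

    index : Ω → E
    index κ = code κ , fromWitness {a? = em} (κ , refl)

    decode-index : ∀ κ → decode (index κ) ≡ κ
    decode-index κ = f-inj tt tt (code-decode (index κ))

    _≺_ : Rel E 0ℓ
    (m , _) ≺ (n , _) = T (isYes (em {Lt m n}))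

    ≺⇒<Ω : ∀ x y → x ≺ y → decode x <Ω decode y
    ≺⇒<Ω x y x≺y with toWitness {a? = em {Lt (proj₁ x) (proj₁ y)}} x≺y
    ... | κ , μ , p , q , κ<μ
      with f-inj {κ} tt tt (trans p (sym (code-decode x))) | f-inj {μ} tt tt (trans q (sym (code-decode y)))
    ...   | refl | refl = κ<μ

    <Ω⇒≺ : ∀ x y → decode x <Ω decode y → x ≺ y
    <Ω⇒≺ x y l = fromWitness {a? = em {Lt (proj₁ x) (proj₁ y)}}
      (decode x , decode y , code-decode x , code-decode y , l)

    decode-cong : ∀ x y → proj₁ x ≡ proj₁ y → decode x ≡ decode y
    decode-cong x y eq = f-inj tt tt (trans (code-decode x) (trans eq (sym (code-decode y))))

    ≺-compare : ∀ x y → Tri (x ≺ y) (proj₁ x ≡ proj₁ y) (y ≺ x)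
    ≺-compare x y with <Ω-compare (decode x) (decode y)
    ... | tri< l ≢ ≯ = tri< (<Ω⇒≺ x y l) (λ eq → ≢ (decode-cong x y eq)) (λ g → ≯ (≺⇒<Ω y x g))
    ... | tri≈ ≮ eq ≯ = tri≈ (λ l → ≮ (≺⇒<Ω x y l))
                             (trans (sym (code-decode x)) (trans (cong code eq) (code-decode y)))
                             (λ g → ≯ (≺⇒<Ω y x g))
    ... | tri> ≮ ≢ g = tri> (λ l → ≮ (≺⇒<Ω x y l)) (λ eq → ≢ (decode-cong x y eq)) (<Ω⇒≺ y x g)

    -- The order of `Ω` carried over to the numbers in use; `index ∘ type` then maps every countable
    -- ordinal into it, as `no-universal-ordinal` forbids.
    ∞ : CountableOrdinal
    ∞ = record
      { dom = λ n → isYes (em {Dom n})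
      ; lt  = λ m n → isYes (em {Lt m n})
      ; isStrictTotalOrder = isStrictTotalOrderᶜ record
        { isEquivalence = On.isEquivalence proj₁ isEquivalence
        ; trans         = λ {x} {y} {z} x≺y y≺z → <Ω⇒≺ x z (<ₒ-trans (≺⇒<Ω x y x≺y) (≺⇒<Ω y z y≺z))
        ; compare       = ≺-compare
        }
      ; wellFounded = Subrelation.wellFounded (λ {x} {y} → ≺⇒<Ω x y) (On.wellFounded decode <Ω-wellFounded)
      }

    index-mono : ∀ {α β} → α <ₒ β → index (type α) ≺ index (type β)
    index-mono {α} {β} α<β = <Ω⇒≺ (index (type α)) (index (type β))
      (subst₂ _<Ω_ (sym (decode-index _)) (sym (decode-index _))
        (<ₒ-respˡ (≅-sym (ordinal-type α)) (<ₒ-respʳ α<β (ordinal-type β))))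

    index-initial : ∀ α y → y ≺ index (type α) → ∃[ x ] index (type (α ↓ x)) ≡ y
    index-initial α y y≺α =
      bound l , Element-≡ ∞ (trans
        (cong code (ordinal-injective (≅-trans (≅-sym (ordinal-type _)) (≅-sym (iso l)))))
        (code-decode y))
      where
      l : ordinal (decode y) <ₒ α
      l = <ₒ-respʳ (subst (decode y <Ω_) (decode-index (type α)) (≺⇒<Ω y (index (type α)) y≺α))
            (≅-sym (ordinal-type α))

  left-inverse : {A B : Set} (h : B → A) → Injective _≡_ _≡_ h → B → Σ (A → B) λ c → ∀ b → c (h b) ≡ b
  left-inverse {A} {B} h h-inj b₀ = (λ a → choose a em) , λ b → retract b em
    where
    choose : ∀ a → Dec (∃[ b ] h b ≡ a) → B
    choose a (yes (b , _)) = b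
    choose a (no _)        = b₀

    retract : ∀ b (d : Dec (∃[ b′ ] h b′ ≡ h b)) → choose (h b) d ≡ b
    retract b (yes (_ , eq)) = h-inj eq
    retract b (no ¬∃)        = ⊥-elim (¬∃ (b , refl))

  -- The forcing

  module _ {I : Set} (y : I → 2^ω) (y-inj : Injective _≡_ _≡_ y) where

    separate : ∀ {κ μ} → κ ≢ μ → ∃[ k ] y κ k ≢ y μ k
    separate κ≢μ = ¬∀⇒∃¬ λ eq → κ≢μ (y-inj (ext eq))

    private
      -- Recursion on `L`: a bit where `y κ` and `y μ` differ sends the side of `y κ` to the tree
      -- `u` for the rest of the list, and leaves the other side, with `y μ`, to `t`.
      adjoin : ∀ t κ b (L : List I) → ¬ κ ∈ₗ L →
        ∃[ u ] eval u (y κ) ≡ b × (∀ {μ} → μ ∈ₗ L → eval u (y μ) ≡ eval t (y μ))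
      adjoin t κ b []      _   = leaf b , refl , λ ()
      adjoin t κ b (μ ∷ L) κ∉L
        with u , uκ , uL ← adjoin t κ b L (κ∉L ∘ there)
        with k , κ≢μ ← separate {κ} {μ} (λ { refl → κ∉L (here refl) })
        = split k (y κ k) u t , trans (eval-split-≡ k (y κ k) u t refl) uκ , agree
        where
        agree : ∀ {ν} → ν ∈ₗ (μ ∷ L) → eval (split k (y κ k) u t) (y ν) ≡ eval t (y ν)
        agree {ν} ν∈ with y ν k ≟ y κ k
        ... | no νk≢κk = eval-split-≢ k (y κ k) u t νk≢κk
        agree (here refl) | yes μk≡κk = ⊥-elim (κ≢μ (sym μk≡κk))
        agree (there ν∈L) | yes νk≡κk = trans (eval-split-≡ k (y κ k) u t νk≡κk) (uL ν∈L)

    interpolate : (b : I → Bool) (L : List I) → ∃[ t ] ∀ {κ} → κ ∈ₗ L → eval t (y κ) ≡ b κ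
    interpolate b []      = leaf false , λ ()
    interpolate b (κ ∷ L) with t , tL ← interpolate b L | em {κ ∈ₗ L}
    ... | yes κ∈L = t , λ { (here refl) → tL κ∈L ; (there μ∈L) → tL μ∈L }
    ... | no κ∉L with u , uκ , uL ← adjoin t κ (b κ) L κ∉L
        = u , λ { (here refl) → uκ ; (there μ∈L) → trans (uL μ∈L) (tL μ∈L) }

    module _ (z : I → 2^ω) where

      -- An entry (m , j , t) of the stem offers t as a code of the clopen set
      -- C m j (several such t may coexist); an entry (κ , m) of the side
      -- condition promises that the sets C m j decide z κ at y κ.
      record Condition : Set where
        field
          stem    : List (ℕ × ℕ × Tree)
          side    : List (I × ℕ)
          correct : ∀ {m j t κ} → (m , j , t) ∈ₗ stem → (κ , m) ∈ₗ side → eval t (y κ) ≡ z κ j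

      open Condition

      infix 4 _≼_

      record _≼_ (p q : Condition) : Set where
        field
          stem-⊇ : stem q ⊆ₗ stem p
          side-⊇ : side q ⊆ₗ side p

      open _≼_

      ≼-refl : ∀ {p} → p ≼ p
      ≼-refl = record { stem-⊇ = λ e → e ; side-⊇ = λ e → e }

      ≼-trans : ∀ {p q r} → p ≼ q → q ≼ r → p ≼ r
      ≼-trans p≼q q≼r = record
        { stem-⊇ = stem-⊇ p≼q ∘ stem-⊇ q≼r
        ; side-⊇ = side-⊇ p≼q ∘ side-⊇ q≼r
        }

      ℙ : Poset 0ℓ 0ℓ 0ℓ
      ℙ = record
        { Carrier = Condition
        -- Conditions extending each other can still list their entries differently; identifying
        -- them makes `_≼_` antisymmetric.
        ; _≈_     = λ p q → p ≼ q × q ≼ p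
        ; _≤_     = _≼_
        ; isPartialOrder = record
          { isPreorder = record
            { isEquivalence = record
              { refl  = ≼-refl , ≼-refl
              ; sym   = λ (p≼q , q≼p) → q≼p , p≼q
              ; trans = λ (p≼q , q≼p) (q≼r , r≼q) → ≼-trans p≼q q≼r , ≼-trans r≼q q≼p
              }
            ; reflexive = proj₁
            ; trans     = ≼-trans
            }
          ; antisym = _,_
          }
        }

      open Forcing ℙ

      -- Correctness relates one stem entry to one side entry at a time, so over a common stem the
      -- side conditions can be joined.
      amalgamate : ∀ p q → stem p ≡ stem q → Compatible p q
      amalgamate p q eq = r
        , record { stem-⊇ = λ e → e ; side-⊇ = xs⊆xs++ys (side p) (side q) }
        , record { stem-⊇ = λ {e} → subst (e ∈ₗ_) (sym eq) ; side-⊇ = xs⊆ys++xs (side q) (side p) }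
        where
        r : Condition
        stem r = stem p
        side r = side p ++ side q
        correct r e∈ κ∈ with ∈-++⁻ (side p) κ∈
        ... | inj₁ κ∈p = correct p e∈ κ∈p
        ... | inj₂ κ∈q = correct q (subst (_ ∈ₗ_) eq e∈) κ∈q

      ccc : CCC
      ccc A antichain = record
        -- Equal conditions may have different stems as lists, so the stem of a representative is
        -- coded. Distinct members of an antichain cannot share it, by `amalgamate`.
        { to        = stem-code ∘ representative-stem
        ; cong      = λ {p} {q} p≈q → cong (stem-code ∘ stem ∘ proj₁) (canon-cong ⟪A⟫ {p} {q} p≈q)
        ; injective = λ {p} {q} eq → Setoid.trans ⟪A⟫ {p} {canon ⟪A⟫ p} {q} (canon-≈ ⟪A⟫ p)
            (Setoid.trans ⟪A⟫ {canon ⟪A⟫ p} {canon ⟪A⟫ q} {q}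
              (same-stem (canon ⟪A⟫ p) (canon ⟪A⟫ q) (stem-code-injective _ _ eq))
              (Setoid.sym ⟪A⟫ {q} {canon ⟪A⟫ q} (canon-≈ ⟪A⟫ q)))
        }
        where
        ⟪A⟫ : Setoid 0ℓ 0ℓ
        ⟪A⟫ = ⟪_⟫ {S = Poset.Eq.setoid ℙ} A

        representative-stem : Setoid.Carrier ⟪A⟫ → List (ℕ × ℕ × Tree)
        representative-stem p = stem (proj₁ (canon ⟪A⟫ p))

        same-stem : ∀ p q → stem (proj₁ p) ≡ stem (proj₁ q) → Setoid._≈_ ⟪A⟫ p q
        same-stem (p , p∈A) (q , q∈A) eq = decidable-stable em λ p≉q →
          antichain p∈A q∈A p≉q (amalgamate p q eq)

      Handled : I → Pred Condition 0ℓ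
      Handled κ p = ∃[ m ] (κ , m) ∈ₗ side p

      Decided : ℕ → ℕ → Pred Condition 0ℓ
      Decided m j p = ∃[ t ] (m , j , t) ∈ₗ stem p

      handle : ∀ κ → Dense (Handled κ)
      handle κ p = q , record { stem-⊇ = λ e → e ; side-⊇ = there } , m , here refl
        where
        -- The stem has no entry for this `m`, so the new promise holds vacuously.
        m = proj₁ (unused (stem p))

        q : Condition
        stem q = stem p
        side q = (κ , m) ∷ side p
        correct q e∈ (here refl)  = ⊥-elim (ℕ.<-irrefl refl (proj₂ (unused (stem p)) e∈))
        correct q e∈ (there μ∈)   = correct p e∈ μ∈

      decide : ∀ m j → Dense (Decided m j)
      decide m j p = q , record { stem-⊇ = there ; side-⊇ = λ e → e } , t , here refl
        where
        -- Only finitely many indices occur in the side condition, so one tree meets all their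
        -- promises, whichever `m` they concern.
        t = proj₁ (interpolate (λ κ → z κ j) (map proj₁ (side p)))

        q : Condition
        stem q = (m , j , t) ∷ stem p
        side q = side p
        correct q (here refl) κ∈ = proj₂ (interpolate (λ κ → z κ j) (map proj₁ (side p))) (∈-map⁺ proj₁ κ∈)
        correct q (there e∈)  κ∈ = correct p e∈ κ∈

      σ-continuous : MA → ¬ Σ (2^ω → I) (Injective _≡_ _≡_) →
        (c : I → ℕ × ℕ) → (∀ mj → ∃[ κ ] c κ ≡ mj) →
        Σ (ℕ → ℕ → Tree) λ t → Σ (I → ℕ) λ m → ∀ κ j → eval (t (m κ) j) (y κ) ≡ z κ j
      σ-continuous ma 2^ω≰I c c-surj = t , m , λ κ j →
        -- One condition in the filter promises `κ` to `m κ`, another carries the tree for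
        -- `(m κ , j)`; a common extension is correct for both.
        let r , _ , r≼p , r≼q = IsFilter.directed F-filter (p∈F κ) (p∈F (index (m κ) j))
        in correct r (stem-⊇ r≼q (t∈ (m κ) j)) (side-⊇ r≼p (proj₂ (proj₁ (p∈G κ))))
        where
        G : I → Pred Condition 0ℓ
        -- The index `κ` is handled and the pair `c κ` decided at once; as `c` is onto, dense sets
        -- indexed by `I` alone suffice.
        G κ = Handled κ ∩ Decided (proj₁ (c κ)) (proj₂ (c κ))

        G-dense : ∀ κ → Dense (G κ)
        G-dense κ p with q , q≼p , (m , κ∈) ← handle κ p
          with r , r≼q , dec ← decide (proj₁ (c κ)) (proj₂ (c κ)) q
          = r , ≼-trans r≼q q≼p , (m , side-⊇ r≼q κ∈) , dec

        𝒟 : Pred (Pred Condition 0ℓ) 0ℓ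
        𝒟 D = ∃[ κ ] D ≐ G κ

        module ≐ = Setoid (≐-setoid Condition 0ℓ)

        I/G : Setoid 0ℓ 0ℓ
        I/G = On.setoid (≐-setoid Condition 0ℓ) G

        𝒟≺2^ω : ⟪_⟫ {S = ≐-setoid Condition 0ℓ} 𝒟 ≺ᶜ 2^ω-setoid
        𝒟≺2^ω = record
          { to        = λ (_ , κ , _) → y (canon I/G κ)
          ; cong      = λ { {D , κ , D≐} {E , μ , E≐} D≐E k → cong (λ ν → y ν k)
              (canon-cong I/G {κ} {μ} (≐.trans {G κ} {D} {G μ} (≐.sym {D} {G κ} D≐) (≐.trans {D} {E} {G μ} D≐E E≐))) }
          ; injective = λ { {D , κ , D≐} {E , μ , E≐} eq →
              ≐.trans {D} {G κ} {E} D≐ (≐.trans {G κ} {G μ} {E}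
                (canon-injective I/G {κ} {μ} (y-inj (ext eq))) (≐.sym {E} {G μ} E≐)) }
          -- A bijection would assign to each real an index naming its dense set, and equal indices
          -- name equal sets: an injection of `2^ω` into `I`.
          } , λ inv → 2^ω≰I
            ( (λ x → proj₁ (proj₂ (Inverse.from inv x)))
            , λ {x} {x′} eq → ext λ k → trans (sym (Inverse.strictlyInverseˡ inv x k))
                (trans (Inverse.to-cong inv (same-index (Inverse.from inv x) (Inverse.from inv x′) eq) k)
                  (Inverse.strictlyInverseˡ inv x′ k)) )
          where
          same-index : (D E : Σ (Pred Condition 0ℓ) 𝒟) → proj₁ (proj₂ D) ≡ proj₁ (proj₂ E) → proj₁ D ≐ proj₁ E
          same-index (D , κ , D≐) (E , .κ , E≐) refl = ≐.trans {D} {G κ} {E} D≐ (≐.sym {E} {G κ} E≐)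

        generic = ma ℙ (record { stem = [] ; side = [] ; correct = λ () }) ccc 𝒟 𝒟≺2^ω
          λ { D (κ , D⊆G , G⊆D) p → let q , q≼p , q∈G = G-dense κ p in q , q≼p , G⊆D q∈G }

        F-filter = proj₁ (proj₂ generic)

        meet : ∀ κ → proj₁ generic ≬ G κ
        meet κ = proj₂ (proj₂ generic) (G κ) (κ , ≐.refl {G κ})

        p∈F : ∀ κ → proj₁ (meet κ) ∈ proj₁ generic
        p∈F κ = proj₁ (proj₂ (meet κ))

        p∈G : ∀ κ → proj₁ (meet κ) ∈ G κ
        p∈G κ = proj₂ (proj₂ (meet κ))

        index : ℕ → ℕ → I
        index m j = proj₁ (c-surj (m , j))

        decided : ∀ m j → Decided m j (proj₁ (meet (index m j)))
        decided m j = subst (λ k → Decided (proj₁ k) (proj₂ k) (proj₁ (meet (index m j))))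
          (proj₂ (c-surj (m , j))) (proj₂ (p∈G (index m j)))

        t : ℕ → ℕ → Tree
        t m j = proj₁ (decided m j)

        t∈ : ∀ m j → (m , j , t m j) ∈ₗ stem (proj₁ (meet (index m j)))
        t∈ m j = proj₂ (decided m j)

        m : I → ℕ
        m κ = proj₁ (proj₁ (p∈G κ))

  -- Comparison of `Ω` with countable sets and with the continuum.

  enumerate : {A : Set} {P : Pred A 0ℓ} → Ctbl P →
    Σ (A → ℕ) λ f → ∀ {a b} → P a → P b → f a ≡ f b → a ≡ b
  enumerate {A} {P} (f , f-inj) = (λ a → rank a em) , λ {a} {b} → rank-injective a b em em
    where
    rank : ∀ a → Dec (P a) → ℕ
    rank a (yes p) = f p
    rank a (no _)  = 0

    rank-injective : ∀ a b (d : Dec (P a)) (e : Dec (P b)) → P a → P b → rank a d ≡ rank b e → a ≡ b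
    rank-injective a b (yes p) (yes q) _ _ eq = f-inj p q eq
    rank-injective a b (no ¬p) _       p _ _  = ⊥-elim (¬p p)
    rank-injective a b (yes _) (no ¬q) _ q _  = ⊥-elim (¬q q)

  -- By trichotomy the rest of `Ω` is `κ` and its countably many predecessors.
  >Ω-¬Ctbl : ∀ κ → ¬ Ctbl (κ <Ω_)
  >Ω-¬Ctbl κ ctbl = Ω-¬Ctbl (Ctbl-⊆ (λ {μ} _ → cover μ) (Ctbl-⋃ ℕ-Ctbl part-Ctbl))
    where
    part : ℕ → Pred Ω 0ℓ
    part 0             = _<Ω κ
    part 1             = _≡ κ
    part (suc (suc _)) = κ <Ω_

    part-Ctbl : ∀ k → Ctbl (part k)
    part-Ctbl 0             = <Ω-initial-Ctbl κ
    part-Ctbl 1             = (λ _ → 0) , λ { refl refl _ → refl }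
    part-Ctbl (suc (suc _)) = ctbl

    cover : ∀ μ → ∃[ k ] part k μ
    cover μ with <Ω-compare μ κ
    ... | tri< μ<κ _ _ = 0 , μ<κ
    ... | tri≈ _ μ≡κ _ = 1 , μ≡κ
    ... | tri> _ _ κ<μ = 2 , κ<μ

  -- Injections both ways would give a bijection of `Ω` with `2^ω`, and `type` turns it into `CH`.
  2^ω≰Ω : ¬ CH → (y : Ω → 2^ω) → Injective _≡_ _≡_ y → ¬ Σ (2^ω → Ω) (Injective _≡_ _≡_)
  2^ω≰Ω ¬ch y y-inj (g , g-inj) with cantor-schröder-bernstein y-inj g-inj
  ... | h , h-inj , h-onto = ¬ch record
    { to        = h ∘ type
    ; from      = ordinal ∘ from
    ; to-cong   = λ f k → cong (λ κ → h κ k) (type-cong f)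
    ; from-cong = λ x≈x′ → subst (λ x → ordinal (from _) ≅ ordinal (from x)) (ext x≈x′) ≅-refl
    ; inverse   = (λ {x} f k → cong (λ w → w k)
                    (trans (cong h (trans (type-cong f) (type-ordinal (from x)))) (proj₂ (h-onto x))))
                , (λ {α} {x} x≈hα → ≅-trans
                    (subst (λ κ → ordinal (from x) ≅ ordinal κ)
                      (h-inj (trans (proj₂ (h-onto x)) (ext x≈hα))) ≅-refl)
                    (≅-sym (ordinal-type α)))
    }
    where
    from : 2^ω → Ω
    from x = proj₁ (h-onto x)

  -- Selecting distinct points along `ℕ` embeds `ℕ × ℕ` into `Ω`; a left inverse of the embedding is
  -- onto.
  Ω-onto-ℕ² : Σ (Ω → ℕ × ℕ) λ c → ∀ mj → ∃[ κ ] c κ ≡ mj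
  Ω-onto-ℕ² = proj₁ c , λ mj → h mj , proj₂ c mj
    where
    initial : ∀ n → Ctbl (_< n)
    initial n = (λ {m} _ → m) , λ _ _ eq → eq

    h : ℕ × ℕ → Ω
    h (m , j) = greedy ℕ.<-wellFounded initial Ω-¬Ctbl (pair m j)

    h-injective : Injective _≡_ _≡_ h
    h-injective {m , j} {m′ , j′} eq
      with pair-injective {m} {j} {m′} {j′} (greedy-injective ℕ.<-wellFounded initial Ω-¬Ctbl ℕ.<-cmp eq)
    ... | refl , refl = refl

    c = left-inverse h h-injective (0 , 0)

  -- The separated pieces

  module _ (ma : MA) (¬ch : ¬ CH) {Y : Pred 2^ω 0ℓ} (Y-¬ctbl : ¬ Ctbl Y) where
    private
      y : Ω → 2^ω
      y = greedy <Ω-wellFounded <Ω-initial-Ctbl Y-¬ctbl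

      y∈Y : ∀ κ → Y (y κ)
      y∈Y = greedy-∈ <Ω-wellFounded <Ω-initial-Ctbl Y-¬ctbl

      y-injective : Injective _≡_ _≡_ y
      y-injective = greedy-injective <Ω-wellFounded <Ω-initial-Ctbl Y-¬ctbl <Ω-compare

      abstract
        e : Ω → Ω → ℕ
        e κ μ = proj₁ (enumerate (<Ω-initial-Ctbl μ)) κ

        e-injective : ∀ {κ κ′ μ} → κ <Ω μ → κ′ <Ω μ → e κ μ ≡ e κ′ μ → κ ≡ κ′
        e-injective {μ = μ} = proj₂ (enumerate (<Ω-initial-Ctbl μ))

      Entry : Ω → ℕ → Set
      Entry μ j = ∃[ κ ] ∃[ i ] κ <Ω μ × pair (e κ μ) i ≡ j

      read : ∀ {μ j} → Dec (Entry μ j) → Bool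
      read (yes (κ , i , _)) = y κ i
      -- Places without an entry get a default; `decode` consults only places that have one.
      read (no _)            = false

      z : Ω → 2^ω
      z μ j = read {μ} {j} em

      z-entry : ∀ {κ μ} → κ <Ω μ → ∀ i → z μ (pair (e κ μ) i) ≡ y κ i
      z-entry {κ} {μ} κ<μ i = read-entry em
        where
        read-entry : (d : Dec (Entry μ (pair (e κ μ) i))) → read d ≡ y κ i
        read-entry (no ¬entry) = ⊥-elim (¬entry (κ , i , κ<μ , refl))
        read-entry (yes (κ′ , i′ , κ′<μ , eq)) with pair-injective {e κ′ μ} {i′} {e κ μ} {i} eq
        -- The entry found by `em` may name another `κ′`, but injectivity of `e` below `μ` forces it
        -- to be `κ`.
        ... | e≡ , refl = cong (λ ν → y ν i) (e-injective κ′<μ κ<μ e≡)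

      abstract
        continuous : Σ (ℕ → ℕ → Tree) λ t → Σ (Ω → ℕ) λ m → ∀ κ j → eval (t (m κ) j) (y κ) ≡ z κ j
        continuous = σ-continuous y y-injective z ma (2^ω≰Ω ¬ch y y-injective) (proj₁ Ω-onto-ℕ²) (proj₂ Ω-onto-ℕ²)

      tree : ℕ → ℕ → Tree
      tree = proj₁ continuous

      m : Ω → ℕ
      m = proj₁ (proj₂ continuous)

      eval-tree : ∀ κ j → eval (tree (m κ) j) (y κ) ≡ z κ j
      eval-tree = proj₂ (proj₂ continuous)

      colour : Ω → Ω → ℕ × ℕ
      colour κ μ = e κ μ , m μ

      -- The tree depends on `μ` only through the colour `k`, so all `y μ` of that colour answer the
      -- same tests with the bits of `y κ`.
      decode : ∀ {κ μ k} → κ <Ω μ → colour κ μ ≡ k → ∀ i → eval (tree (proj₂ k) (pair (proj₁ k) i)) (y μ) ≡ y κ i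
      decode {κ} {μ} κ<μ refl i = trans (eval-tree μ (pair (e κ μ) i)) (z-entry κ<μ i)

      abstract
        popular : ∀ κ → ∃[ k ] ¬ Ctbl (λ μ → κ <Ω μ × colour κ μ ≡ k)
        popular κ = pigeonhole ℕ²-Ctbl (colour κ) (>Ω-¬Ctbl κ)

        common : ∃[ k ] ¬ Ctbl (λ κ → U κ × proj₁ (popular κ) ≡ k)
        common = pigeonhole ℕ²-Ctbl (proj₁ ∘ popular) Ω-¬Ctbl

      k₀ : ℕ × ℕ
      k₀ = proj₁ common

      -- Re-indexes the uncountably many `κ` with popular colour `k₀` by all of `Ω`, without
      -- repetition.
      h : Ω → Ω
      h = greedy <Ω-wellFounded <Ω-initial-Ctbl (proj₂ common)

      h-popular : ∀ κ → proj₁ (popular (h κ)) ≡ k₀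
      h-popular κ = proj₂ (greedy-∈ <Ω-wellFounded <Ω-initial-Ctbl (proj₂ common) κ)

      h-injective : Injective _≡_ _≡_ h
      h-injective = greedy-injective <Ω-wellFounded <Ω-initial-Ctbl (proj₂ common) <Ω-compare

      piece : Ω → Pred 2^ω 0ℓ
      piece κ x = ∃[ μ ] x ≡ y μ × h κ <Ω μ × colour (h κ) μ ≡ k₀

      piece-⊆ : ∀ κ → piece κ ⊆ Y
      piece-⊆ κ (μ , refl , _) = y∈Y μ

      piece-¬Ctbl : ∀ κ → ¬ Ctbl (piece κ)
      piece-¬Ctbl κ ctbl = proj₂ (popular (h κ)) (Ctbl-preimage y
        (λ {μ} (l , eq) → μ , refl , l , trans eq (h-popular κ)) (λ _ _ → y-injective) ctbl)

      test : ℕ → Tree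
      test i = tree (proj₂ k₀) (pair (proj₁ k₀) i)

      piece-decodes : ∀ κ → Decodes test (piece κ) (y (h κ))
      piece-decodes κ (μ , refl , hκ<μ , eq) i = decode hκ<μ eq i

      -- A point in both closures would decode, by the same tests, to both `y (h κ)` and `y (h μ)`.
      piece-disjoint : ∀ {κ μ} → κ ≢ μ → cl (piece κ) ⊥ cl (piece μ)
      piece-disjoint {κ} {μ} κ≢μ (x∈κ , x∈μ) = κ≢μ (h-injective (y-injective (ext λ i → trans
        (sym (cl-decodes test (piece-decodes κ) x∈κ i))
        (cl-decodes test (piece-decodes μ) x∈μ i))))

    separated-pieces : Σ (Func ω₁ (≐-setoid 2^ω 0ℓ)) λ 𝒴 →
      (∀ α → Func.to 𝒴 α ⊆ Y × Uncountable (Func.to 𝒴 α)) ×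
      (∀ α β → ¬ (α ≅ β) → cl (Func.to 𝒴 α) ⊥ cl (Func.to 𝒴 β))
    separated-pieces =
        record { to   = piece ∘ type
               ; cong = λ {α} f → subst (λ κ → piece (type α) ≐ piece κ) (type-cong f) ((λ x∈ → x∈) , (λ x∈ → x∈)) }
      , (λ α → piece-⊆ (type α) , ¬Ctbl⇒Uncountable (piece-¬Ctbl (type α)))
      , λ α β α≇β → piece-disjoint λ eq → α≇β
          (≅-trans (ordinal-type α) (subst (λ κ → ordinal κ ≅ β) (sym eq) (≅-sym (ordinal-type β))))

theorem13 : Classical → MA → ¬ CH → Grinzing U
theorem13 (em , ext) ma ¬ch =
    ¬Ctbl⇒Uncountable 2^ω-¬Ctbl
  , λ Y _ Y-uncountable → separated-pieces ma ¬ch (Uncountable⇒¬Ctbl Y-uncountable)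
  where
  em₀ : ∀ {P : Set} → Dec P
  em₀ = map′ lower lift em

  ext₀ : Extensionality 0ℓ 0ℓ
  ext₀ = lower-extensionality _ _ ext

  open Classically em₀ ext₀
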